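{- Let $G=(V,E)$ be a graph with maximum degree $r \ge 3$. Let $|\mathcal{IG}|$ and $|\mathcal{MG}|$ be the (random) cardinalities of the independent set and of the matching, respectively, produced by the randomized GREEDY algorithm on $G$. Then $$\mathrm{Var}\left[\frac{|\mathcal{IG}|}{|V|}\right] \le \frac{ 9 r^2 e^{(r-1)^3}}{|V|}\qquad\text{and}\qquad \mathrm{Var}\left[\frac{|\mathcal{MG}|}{|E|}\right] \le \frac{ 33 r^2 e^{(r-1)^3}}{|E|}.$$
   Context: All graphs are finite, simple and undirected. Randomized GREEDY for (unweighted) independent sets: iteratively select a node uniformly at random from all remaining nodes of the graph, add it to the independent set, delete it and all remaining nodes adjacent to it, and repeat until no nodes remain; the random output is $\mathcal{IG}$. Randomized GREEDY for (unweighted) matchings: iteratively select an edge uniformly at random from all remaining edges, add it to the matching, delete it and all remaining edges sharing an endpoint with it, and repeat until no edges remain; the random output is $\mathcal{MG}$. -}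

module Defs where

open import Data.Fin.Base as Fin using (Fin)
import Data.Fin.Properties as Fin
open import Data.Integer.Base as ℤ using (+_; +[1+_]; 1ℤ)
import Data.Integer.Properties as ℤ
open import Data.List.Base using (List; []; _∷_; [_]; map; concatMap; foldr; filter; length; allFin; cartesianProduct)
open import Data.List.Extrema.Nat using (max; max≤v⁺)
open import Data.List.Membership.Propositional using (_∈_)
open import Data.List.Membership.Propositional.Properties using (∈-allFin; ∈-cartesianProduct⁺; ∈-filter⁺; ∈-filter⁻; ∈-length)
import Data.List.Relation.Unary.All as All
import Data.List.Relation.Unary.All.Properties as All
open import Data.List.Relation.Unary.Any using (here)
open import Data.Nat.Base as ℕ using (ℕ; zero; suc; z≤n; s≤s; _!)
import Data.Nat.Properties as ℕ
open import Data.Nat.Tactic.RingSolver using (solve-∀)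
open import Data.Product.Base using (_×_; _,_; ∃; proj₁; proj₂; map₁)
open import Data.Rational.Base as ℚ using (ℚ; mkℚ; 0ℚ; 1ℚ; _/_; Positive; toℚᵘ; ∣_∣)
import Data.Rational.Properties as ℚ
import Data.Rational.Unnormalised.Base as ℚᵘ
import Data.Rational.Unnormalised.Properties as ℚᵘ
open import Data.Sum.Base using (_⊎_; inj₁; inj₂; [_,_]′)
open import Level using (0ℓ)
open import Relation.Binary.Core using (Rel)
open import Relation.Binary.Definitions using (Symmetric; Irreflexive; Decidable; tri<; tri≈; tri>)
open import Relation.Binary.PropositionalEquality using (_≡_; refl; sym; trans; cong; subst; subst₂)
open import Relation.Nullary using (¬_; ¬?; yes; no; contradiction)
open import Relation.Nullary.Decidable using (_⊎-dec_; _×-dec_)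

private
  variable
    A B : Set

IsCauchy : (ℕ → ℚ) → Set
IsCauchy x = ∀ ε → .{{Positive ε}} →
  ∃ λ N → ∀ m n → N ℕ.≤ m → N ℕ.≤ n → ∣ x m ℚ.- x n ∣ ℚ.≤ ε

record ℝ : Set where
  constructor mkℝ
  field
    approx : ℕ → ℚ
    cauchy : IsCauchy approx

open ℝ public

infix 4 _≤ℝ_

_≤ℝ_ : Rel ℝ 0ℓ
x ≤ℝ y = ∀ ε → .{{Positive ε}} →
  ∃ λ N → ∀ n → N ℕ.≤ n → approx x n ℚ.≤ approx y n ℚ.+ ε

fromℚ : ℚ → ℝ
fromℚ q .approx _ = q
fromℚ q .cauchy ε = 0 , λ _ _ _ _ → begin
  ∣ q ℚ.- q ∣  ≡⟨ cong ∣_∣ (ℚ.+-inverseʳ q) ⟩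
  0ℚ           ≤⟨ ℚ.<⇒≤ (ℚ.positive⁻¹ ε) ⟩
  ε            ∎
  where open ℚ.≤-Reasoning

private
  scale-cauchy : ∀ c {x} → IsCauchy x → IsCauchy (λ n → c ℚ.* x n)
  scale-cauchy c {x} x-cauchy ε = proj₁ tail , λ m n N≤m N≤n → begin
    ∣ c ℚ.* x m ℚ.- c ℚ.* x n ∣         ≡⟨ cong (λ z → ∣ c ℚ.* x m ℚ.+ z ∣) (ℚ.neg-distribʳ-* c (x n)) ⟩
    ∣ c ℚ.* x m ℚ.+ c ℚ.* (ℚ.- x n) ∣   ≡⟨ cong ∣_∣ (ℚ.*-distribˡ-+ c (x m) (ℚ.- x n)) ⟨
    ∣ c ℚ.* (x m ℚ.- x n) ∣             ≡⟨ ℚ.∣p*q∣≡∣p∣*∣q∣ c (x m ℚ.- x n) ⟩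
    ∣ c ∣ ℚ.* ∣ x m ℚ.- x n ∣           ≤⟨ ℚ.*-monoˡ-≤-nonNeg ∣ c ∣ (proj₂ tail m n N≤m N≤n) ⟩
    ∣ c ∣ ℚ.* δ                         ≤⟨ ℚ.*-monoʳ-≤-nonNeg δ {{ℚ.pos⇒nonNeg δ}} ∣c∣≤b ⟩
    b ℚ.* (ℚ.1/ b ℚ.* ε)                ≡⟨ ℚ.*-assoc b (ℚ.1/ b) ε ⟨
    b ℚ.* ℚ.1/ b ℚ.* ε                  ≡⟨ cong (ℚ._* ε) (ℚ.*-inverseʳ b) ⟩
    1ℚ ℚ.* ε                            ≡⟨ ℚ.*-identityˡ ε ⟩
    ε                                   ∎
    where
    open ℚ.≤-Reasoning
    b = 1ℚ ℚ.+ ∣ c ∣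
    instance
      ∣c∣≥0 : ℚ.NonNegative ∣ c ∣
      ∣c∣≥0 = ℚ.∣-∣-nonNeg c
      b>0 : Positive b
      b>0 = ℚ.pos+nonNeg⇒pos 1ℚ ∣ c ∣
      b≢0 : ℚ.NonZero b
      b≢0 = ℚ.pos⇒nonZero b
      1/b>0 : Positive (ℚ.1/ b)
      1/b>0 = ℚ.1/pos⇒pos b
    δ = ℚ.1/ b ℚ.* ε
    instance
      δ>0 : Positive δ
      δ>0 = ℚ.pos*pos⇒pos (ℚ.1/ b) ε
    tail = x-cauchy δ
    ∣c∣≤b : ∣ c ∣ ℚ.≤ b
    ∣c∣≤b = begin
      ∣ c ∣          ≡⟨ ℚ.+-identityˡ ∣ c ∣ ⟨
      0ℚ ℚ.+ ∣ c ∣   ≤⟨ ℚ.+-monoˡ-≤ ∣ c ∣ (ℚ.<⇒≤ (ℚ.positive⁻¹ 1ℚ)) ⟩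
      b              ∎

infixr 7 _·_

_·_ : ℚ → ℝ → ℝ
(c · x) .approx n = c ℚ.* approx x n
(c · x) .cauchy   = scale-cauchy c (cauchy x)

expTerm : ℕ → ℕ → ℚ
expTerm x k = (+ (x ℕ.^ k) / (k !)) {{k ℕ.!≢0}}

expSum : ℕ → ℕ → ℚ
expSum x zero    = 0ℚ
expSum x (suc n) = expSum x n ℚ.+ expTerm x n

private
  toℚᵘ-/ : ∀ i n .{{_ : ℕ.NonZero n}} → toℚᵘ (i / n) ℚᵘ.≃ i ℚᵘ./ n
  toℚᵘ-/ i (suc n) = ℚ.toℚᵘ-fromℚᵘ (ℚᵘ.mkℚᵘ i n)

  /-mono : ∀ a b c d .{{_ : ℕ.NonZero b}} .{{_ : ℕ.NonZero d}} →
           a ℕ.* d ℕ.≤ c ℕ.* b → + a / b ℚ.≤ + c / d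
  /-mono a b@(suc _) c d@(suc _) ad≤cb = ℚ.toℚᵘ-cancel-≤ (begin
    toℚᵘ (+ a / b)  ≃⟨ toℚᵘ-/ (+ a) b ⟩
    + a ℚᵘ./ b      ≤⟨ ℚᵘ.*≤* (subst₂ ℤ._≤_ (ℤ.pos-* a d) (ℤ.pos-* c b) (ℤ.+≤+ ad≤cb)) ⟩
    + c ℚᵘ./ d      ≃⟨ toℚᵘ-/ (+ c) d ⟨
    toℚᵘ (+ c / d)  ∎)
    where open ℚᵘ.≤-Reasoning

  /-double : ∀ a n .{{_ : ℕ.NonZero n}} → + a / n ℚ.+ + a / n ≡ + (2 ℕ.* a) / n
  /-double a n@(suc _) = ℚ.toℚᵘ-injective (begin
    toℚᵘ (+ a / n ℚ.+ + a / n)            ≈⟨ ℚ.toℚᵘ-homo-+ (+ a / n) (+ a / n) ⟩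
    toℚᵘ (+ a / n) ℚᵘ.+ toℚᵘ (+ a / n)    ≈⟨ ℚᵘ.+-cong (toℚᵘ-/ (+ a) n) (toℚᵘ-/ (+ a) n) ⟩
    (+ a ℚᵘ./ n) ℚᵘ.+ (+ a ℚᵘ./ n)        ≈⟨ ℚᵘ.*≡* eq ⟩
    + (2 ℕ.* a) ℚᵘ./ n                    ≈⟨ toℚᵘ-/ (+ (2 ℕ.* a)) n ⟨
    toℚᵘ (+ (2 ℕ.* a) / n)                ∎)
    where
    open ℚᵘ.≃-Reasoning
    nat : ∀ a n → (a ℕ.* n ℕ.+ a ℕ.* n) ℕ.* n ≡ (2 ℕ.* a) ℕ.* (n ℕ.* n)
    nat = solve-∀
    eq : (+ a ℤ.* + n ℤ.+ + a ℤ.* + n) ℤ.* + n ≡ + (2 ℕ.* a) ℤ.* + (n ℕ.* n)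
    eq = trans (cong (λ z → (z ℤ.+ z) ℤ.* + n) (sym (ℤ.pos-* a n)))
        (trans (sym (ℤ.pos-* (a ℕ.* n ℕ.+ a ℕ.* n) n))
        (trans (cong +_ (nat a n)) (ℤ.pos-* (2 ℕ.* a) (n ℕ.* n))))

  expTerm-nonNeg : ∀ x k → 0ℚ ℚ.≤ expTerm x k
  expTerm-nonNeg x k = /-mono 0 1 (x ℕ.^ k) (k !) {{_}} {{k ℕ.!≢0}} z≤n

  expTerm-halves : ∀ x k → 2 ℕ.* x ℕ.≤ k →
                   expTerm x (suc k) ℚ.+ expTerm x (suc k) ℚ.≤ expTerm x k
  expTerm-halves x k 2x≤k = begin
    expTerm x (suc k) ℚ.+ expTerm x (suc k)     ≡⟨ /-double (x ℕ.^ suc k) (suc k !) ⟩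
    + (2 ℕ.* x ℕ.^ suc k) / (suc k !)           ≤⟨ /-mono (2 ℕ.* x ℕ.^ suc k) (suc k !) (x ℕ.^ k) (k !) nat ⟩
    expTerm x k                                 ∎
    where
    open ℚ.≤-Reasoning
    instance
      _ = k ℕ.!≢0
      _ = suc k ℕ.!≢0
    lhs : ∀ x p f → 2 ℕ.* (x ℕ.* p) ℕ.* f ≡ (2 ℕ.* x) ℕ.* (p ℕ.* f)
    lhs = solve-∀
    rhs : ∀ n p f → n ℕ.* (p ℕ.* f) ≡ p ℕ.* (n ℕ.* f)
    rhs = solve-∀
    nat : 2 ℕ.* x ℕ.^ suc k ℕ.* k ! ℕ.≤ x ℕ.^ k ℕ.* suc k !
    nat = subst₂ ℕ._≤_ (sym (lhs x (x ℕ.^ k) (k !))) (rhs (suc k) (x ℕ.^ k) (k !))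
                 (ℕ.*-monoˡ-≤ (x ℕ.^ k ℕ.* k !) (ℕ.≤-trans 2x≤k (ℕ.n≤1+n k)))

  expSum-mono : ∀ x {N m} → N ℕ.≤′ m → expSum x N ℚ.≤ expSum x m
  expSum-mono x ℕ.≤′-refl = ℚ.≤-refl
  expSum-mono x {N} {suc m} (ℕ.≤′-step N≤m) = begin
    expSum x N                        ≤⟨ expSum-mono x N≤m ⟩
    expSum x m                        ≡⟨ ℚ.+-identityʳ (expSum x m) ⟨
    expSum x m ℚ.+ 0ℚ                 ≤⟨ ℚ.+-monoʳ-≤ (expSum x m) (expTerm-nonNeg x m) ⟩
    expSum x m ℚ.+ expTerm x m        ∎
    where open ℚ.≤-Reasoning

  expUpper : ℕ → ℕ → ℚ
  expUpper x n = expSum x n ℚ.+ (expTerm x n ℚ.+ expTerm x n)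

  expUpper-anti : ∀ x {N m} → 2 ℕ.* x ℕ.≤ N → N ℕ.≤′ m → expUpper x m ℚ.≤ expUpper x N
  expUpper-anti x 2x≤N ℕ.≤′-refl = ℚ.≤-refl
  expUpper-anti x {N} {suc m} 2x≤N (ℕ.≤′-step N≤m) = begin
    expUpper x (suc m)
      ≤⟨ ℚ.+-monoʳ-≤ (expSum x (suc m)) (expTerm-halves x m (ℕ.≤-trans 2x≤N (ℕ.≤′⇒≤ N≤m))) ⟩
    expSum x m ℚ.+ expTerm x m ℚ.+ expTerm x m
      ≡⟨ ℚ.+-assoc (expSum x m) (expTerm x m) (expTerm x m) ⟩
    expUpper x m
      ≤⟨ expUpper-anti x 2x≤N N≤m ⟩
    expUpper x N
      ∎
    where open ℚ.≤-Reasoning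

  expSum≤expUpper : ∀ x m → expSum x m ℚ.≤ expUpper x m
  expSum≤expUpper x m = begin
    expSum x m                     ≡⟨ ℚ.+-identityʳ (expSum x m) ⟨
    expSum x m ℚ.+ (0ℚ ℚ.+ 0ℚ)     ≤⟨ ℚ.+-monoʳ-≤ (expSum x m) (ℚ.+-mono-≤ (expTerm-nonNeg x m) (expTerm-nonNeg x m)) ⟩
    expUpper x m                   ∎
    where open ℚ.≤-Reasoning

  ^≤! : ∀ x k → x ℕ.^ suc k ℕ.≤ x ℕ.^ suc x ℕ.* k !
  ^≤! zero k = z≤n
  ^≤! x@(suc _) zero = ℕ.≤-trans (ℕ.^-monoʳ-≤ x {1} {suc x} (s≤s z≤n)) (ℕ.≤-reflexive (sym (ℕ.*-identityʳ (x ℕ.^ suc x))))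
  ^≤! x@(suc _) (suc k) with suc k ℕ.≤? x
  ... | yes 1+k≤x = begin
    x ℕ.^ suc (suc k)                ≤⟨ ℕ.^-monoʳ-≤ x (s≤s 1+k≤x) ⟩
    x ℕ.^ suc x                      ≤⟨ ℕ.m≤m*n (x ℕ.^ suc x) (suc k !) {{suc k ℕ.!≢0}} ⟩
    x ℕ.^ suc x ℕ.* suc k !          ∎
    where open ℕ.≤-Reasoning
  ... | no 1+k≰x = begin
    x ℕ.* x ℕ.^ suc k                ≤⟨ ℕ.*-mono-≤ (ℕ.<⇒≤ (ℕ.≰⇒> 1+k≰x)) (^≤! x k) ⟩
    suc k ℕ.* (x ℕ.^ suc x ℕ.* k !)  ≡⟨ swap (suc k) (x ℕ.^ suc x) (k !) ⟩
    x ℕ.^ suc x ℕ.* suc k !          ∎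
    where
    open ℕ.≤-Reasoning
    swap : ∀ n p f → n ℕ.* (p ℕ.* f) ≡ p ℕ.* (n ℕ.* f)
    swap = solve-∀

  expTerm-small : ∀ x ε → .{{Positive ε}} →
                  ∃ λ N → 2 ℕ.* x ℕ.≤ N × expTerm x N ℚ.+ expTerm x N ℚ.≤ ε
  expTerm-small x ε@(mkℚ +[1+ p ] q-1 _) = suc M , ℕ.≤-trans (ℕ.m≤m+n _ _) (ℕ.n≤1+n M) , (begin
    expTerm x (suc M) ℚ.+ expTerm x (suc M)  ≡⟨ /-double (x ℕ.^ suc M) (suc M !) ⟩
    + (2 ℕ.* x ℕ.^ suc M) / (suc M !)        ≤⟨ /-mono (2 ℕ.* x ℕ.^ suc M) (suc M !) (suc p) q nat ⟩
    + (suc p) / q                            ≡⟨ ℚ.↥p/↧p≡p ε ⟩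
    ε                                        ∎)
    where
    open ℚ.≤-Reasoning
    q = suc q-1
    C = 2 ℕ.* q ℕ.* x ℕ.^ suc x
    M = 2 ℕ.* x ℕ.+ C
    instance _ = suc M ℕ.!≢0
    lhs : ∀ q b f → 2 ℕ.* (b ℕ.* f) ℕ.* q ≡ 2 ℕ.* q ℕ.* b ℕ.* f
    lhs = solve-∀
    nat : 2 ℕ.* x ℕ.^ suc M ℕ.* q ℕ.≤ suc p ℕ.* suc M !
    nat = ℕ.≤-trans (ℕ.*-monoˡ-≤ q (ℕ.*-monoʳ-≤ 2 (^≤! x M)))
         (ℕ.≤-trans (ℕ.≤-reflexive (lhs q (x ℕ.^ suc x) (M !)))
         (ℕ.≤-trans (ℕ.*-monoˡ-≤ (M !) (ℕ.≤-trans (ℕ.m≤n+m C (2 ℕ.* x)) (ℕ.n≤1+n M)))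
                    (ℕ.m≤m+n (suc M !) (p ℕ.* suc M !))))

  ∣-∣-between : ∀ {a d p q} → a ℚ.≤ p → p ℚ.≤ a ℚ.+ d → a ℚ.≤ q → q ℚ.≤ a ℚ.+ d → ∣ p ℚ.- q ∣ ℚ.≤ d
  ∣-∣-between {a} {d} {p} {q} a≤p p≤a+d a≤q q≤a+d =
    [ (λ eq → subst (ℚ._≤ d) (sym eq) (diff a≤q p≤a+d))
    , (λ eq → subst (ℚ._≤ d) (sym (trans eq (flip-neg p q))) (diff a≤p q≤a+d))
    ]′ (ℚ.∣p∣≡p∨∣p∣≡-p (p ℚ.- q))
    where
    open ℚ.≤-Reasoning
    diff : ∀ {p q} → a ℚ.≤ q → p ℚ.≤ a ℚ.+ d → p ℚ.- q ℚ.≤ d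
    diff {p} {q} a≤q p≤a+d = begin
      p ℚ.- q              ≤⟨ ℚ.+-mono-≤ p≤a+d (ℚ.neg-antimono-≤ a≤q) ⟩
      a ℚ.+ d ℚ.- a        ≡⟨ cong (ℚ._- a) (ℚ.+-comm a d) ⟩
      d ℚ.+ a ℚ.- a        ≡⟨ ℚ.+-assoc d a (ℚ.- a) ⟩
      d ℚ.+ (a ℚ.- a)      ≡⟨ cong (d ℚ.+_) (ℚ.+-inverseʳ a) ⟩
      d ℚ.+ 0ℚ             ≡⟨ ℚ.+-identityʳ d ⟩
      d                    ∎
    open import Algebra.Properties.Group ℚ.+-0-group using (⁻¹-involutive)
    flip-neg : ∀ p q → ℚ.- (p ℚ.- q) ≡ q ℚ.- p
    flip-neg p q = trans (ℚ.neg-distrib-+ p (ℚ.- q))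
                  (trans (cong (ℚ.- p ℚ.+_) (⁻¹-involutive q)) (ℚ.+-comm (ℚ.- p) q))

  expSum-cauchy : ∀ x → IsCauchy (expSum x)
  expSum-cauchy x ε with N , 2x≤N , small ← expTerm-small x ε =
    N , λ m n N≤m N≤n → ℚ.≤-trans
      (∣-∣-between (lower N≤m) (upper N≤m) (lower N≤n) (upper N≤n)) small
    where
    lower : ∀ {N m} → N ℕ.≤ m → expSum x N ℚ.≤ expSum x m
    lower N≤m = expSum-mono x (ℕ.≤⇒≤′ N≤m)
    upper : ∀ {m} → N ℕ.≤ m → expSum x m ℚ.≤ expUpper x N
    upper {m} N≤m = ℚ.≤-trans (expSum≤expUpper x m) (expUpper-anti x 2x≤N (ℕ.≤⇒≤′ N≤m))

-- Only natural exponents are needed: exp x is the sum of the series of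
-- x ^ k / k ! over all k.

exp : ℕ → ℝ
exp x .approx = expSum x
exp x .cauchy = expSum-cauchy x

-- Weighted outcomes; the same outcome may be listed several times, and
-- its probability is then the sum of its weights.

Dist : Set → Set
Dist A = List (ℚ × A)

pure : A → Dist A
pure a = [ (1ℚ , a) ]

infixl 1 _>>=_

_>>=_ : Dist A → (A → Dist B) → Dist B
d >>= k = concatMap (λ (p , a) → map (map₁ (p ℚ.*_)) (k a)) d

uniform : List A → Dist A
uniform []         = []
uniform xs@(_ ∷ _) = map (1ℤ / length xs ,_) xs

𝔼 : Dist A → (A → ℚ) → ℚ
𝔼 d X = foldr (λ (p , a) s → p ℚ.* X a ℚ.+ s) 0ℚ d

Var : Dist A → (A → ℚ) → ℚ
Var d X = 𝔼 d (λ a → (X a ℚ.- μ) ℚ.* (X a ℚ.- μ))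
  where μ = 𝔼 d X

-- A selected item is deleted together with everything it conflicts
-- with.  In both uses below _#_ is reflexive, so every step shortens the
-- list of remaining items and length xs steps always suffice.

module _ {_#_ : Rel A 0ℓ} (_#?_ : Decidable _#_) where

  greedySteps : ℕ → List A → Dist (List A)
  greedySteps zero    _          = pure []
  greedySteps (suc k) []         = pure []
  greedySteps (suc k) xs@(_ ∷ _) =
    uniform xs >>= λ x →
    greedySteps k (filter (λ y → ¬? (x #? y)) xs) >>= λ S →
    pure (x ∷ S)

  greedy : List A → Dist (List A)
  greedy xs = greedySteps (length xs) xs

record Graph (n : ℕ) : Set₁ where
  field
    _~_      : Rel (Fin n) 0ℓ
    _~?_     : Decidable _~_
    ~-sym    : Symmetric _~_
    ~-irrefl : Irreflexive _≡_ _~_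

module _ {n} (G : Graph n) where
  open Graph G

  degree : Fin n → ℕ
  degree v = length (filter (v ~?_) (allFin n))

  maxDegree : ℕ
  maxDegree = max 0 (map degree (allFin n))

  -- Each edge {i , j} is listed once, as the pair with i < j.

  edges : List (Fin n × Fin n)
  edges = filter (λ (i , j) → (i Fin.<? j) ×-dec (i ~? j)) (cartesianProduct (allFin n) (allFin n))

  ∣V∣ ∣E∣ : ℕ
  ∣V∣ = n
  ∣E∣ = length edges

  EqualOrAdjacent : Rel (Fin n) 0ℓ
  EqualOrAdjacent u v = u ≡ v ⊎ u ~ v

  equalOrAdjacent? : Decidable EqualOrAdjacent
  equalOrAdjacent? u v = (u Fin.≟ v) ⊎-dec (u ~? v)

  ShareEndpoint : Rel (Fin n × Fin n) 0ℓ
  ShareEndpoint (i , j) (k , l) = (i ≡ k ⊎ i ≡ l) ⊎ (j ≡ k ⊎ j ≡ l)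

  shareEndpoint? : Decidable ShareEndpoint
  shareEndpoint? (i , j) (k , l) =
    ((i Fin.≟ k) ⊎-dec (i Fin.≟ l)) ⊎-dec ((j Fin.≟ k) ⊎-dec (j Fin.≟ l))

  𝓘𝓖 : Dist (List (Fin n))
  𝓘𝓖 = greedy equalOrAdjacent? (allFin n)

  𝓜𝓖 : Dist (List (Fin n × Fin n))
  𝓜𝓖 = greedy shareEndpoint? edges

  private
    edge-listed : ∀ {u v} → u ~ v → 0 ℕ.< ∣E∣
    edge-listed {u} {v} u~v with Fin.<-cmp u v
    ... | tri< u<v _ _ = ∈-length (∈-filter⁺ _ (∈-cartesianProduct⁺ (∈-allFin u) (∈-allFin v)) (u<v , u~v))
    ... | tri≈ _ u≡v _ = contradiction u~v (~-irrefl u≡v)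
    ... | tri> _ _ v<u = ∈-length (∈-filter⁺ _ (∈-cartesianProduct⁺ (∈-allFin v) (∈-allFin u)) (v<u , ~-sym u~v))

    degree≡0 : ∣E∣ ≡ 0 → ∀ v → degree v ℕ.≤ 0
    degree≡0 E≡0 v with filter (v ~?_) (allFin n) in eq
    ... | []    = z≤n
    ... | u ∷ _ = contradiction (sym E≡0) (ℕ.<⇒≢ (edge-listed v~u))
      where
      v~u : v ~ u
      v~u = proj₂ (∈-filter⁻ (v ~?_) {xs = allFin n} (subst (u ∈_) (sym eq) (here refl)))

  ∣E∣-nonZero : 0 ℕ.< maxDegree → ℕ.NonZero ∣E∣
  ∣E∣-nonZero Δ>0 = ℕ.≢-nonZero λ E≡0 →
    ℕ.<⇒≱ Δ>0 (max≤v⁺ z≤n (All.map⁺ (All.universal (degree≡0 E≡0) (allFin n))))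

∣V∣-nonZero : ∀ {n} (G : Graph n) → 0 ℕ.< maxDegree G → ℕ.NonZero (∣V∣ G)
∣V∣-nonZero {suc _} _ _ = _

{-# OPTIONS --safe #-}

-- Write e(H) for the expected greedy output size on the conflict graph H and
-- H ∖ x for H minus the closed neighbourhood of x.  Conditioning on the first
-- pick gives |H| e(H) = ∑ₓ (1 + e(H ∖ x)), and hence, for a vertex v,
--   |H| (e(H) − e(H − v)) = ∑_{x ≠ v} (e(H ∖ x) − e((H − v) ∖ x)) + 1 + e(H ∖ v) − e(H − v).
-- The summand vanishes if x is adjacent to v.  Since H ∖ v is H − v minus the
-- deg v neighbours of v, induction bounds the right side by
-- (|H| − 1 − deg v) + 1 + deg v = |H|, so e changes by at most 1 when a single
-- vertex is deleted.  Therefore a pick that deletes at most D vertices moves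
-- the conditional expectation of the output size by at most 1 + D, and the
-- martingale of these conditional expectations yields a variance of at most
-- (1 + D)² |H|.  Here 1 + D ≤ 3r in both cases, and exp only needs to be ≥ 1.

module Submission where

open import Defs
open import Data.Bool.Base using (true; false; if_then_else_)
open import Data.Fin.Base as Fin using (Fin)
import Data.Fin.Properties as Fin
open import Data.Integer.Base as ℤ using (+_; 1ℤ)
import Data.Integer.Properties as ℤ
open import Data.List.Base using (List; []; _∷_; [_]; _++_; map; filter; length; allFin; cartesianProduct)
import Data.List.Properties as List
import Data.List.Extrema.Nat as Extrema
open import Data.List.Membership.Propositional using (_∈_)
open import Data.List.Membership.Propositional.Properties
  using (∈-allFin; ∈-filter⁺; ∈-filter⁻; ∈-map⁺; ∈-∃++; ∈-++⁺ˡ; ∈-++⁺ʳ; ∈-++⁻)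
open import Data.List.Relation.Binary.Sublist.Propositional using (_⊆_; []; _∷_; _∷ʳ_)
import Data.List.Relation.Binary.Sublist.Propositional.Properties as Sublist
import Data.List.Relation.Unary.All as All
open import Data.List.Relation.Unary.Any as Any using (here; there)
open import Data.List.Relation.Unary.Unique.Propositional using (Unique; []; _∷_)
import Data.List.Relation.Unary.Unique.Propositional.Properties as Unique
open import Data.Nat.Base as ℕ using (ℕ; zero; suc; _∸_; s≤s; z≤n)
import Data.Nat.Properties as ℕ
open import Data.Nat.Tactic.RingSolver using () renaming (solve-∀ to ℕ-solve-∀)
open import Data.Product.Base using (_×_; _,_; proj₂; map₁)
open import Data.Rational.Base as ℚ using (ℚ; 0ℚ; 1ℚ; _/_; ∣_∣; Positive; NonNegative; toℚᵘ)
import Data.Rational.Properties as ℚ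
import Data.Rational.Unnormalised.Base as ℚᵘ
import Data.Rational.Unnormalised.Properties as ℚᵘ
open import Data.Sum.Base using (inj₁; inj₂; [_,_]′)
open import Function.Base using (_∘_; id)
open import Level using (0ℓ)
open import Relation.Binary.Core using (Rel)
open import Relation.Binary.Definitions using (Decidable; Reflexive; Symmetric)
open import Relation.Binary.PropositionalEquality
  using (_≡_; _≢_; refl; sym; trans; cong; cong₂; subst; module ≡-Reasoning)
open import Relation.Nullary using (¬?; yes; no; does; contradiction)
open import Relation.Nullary.Decidable using (Dec; dec⇒maybe; dec-true; dec-false; _×-dec_)
import Relation.Unary as Unary
open import Tactic.RingSolver using (solve-∀)
open import Tactic.RingSolver.Core.AlmostCommutativeRing using (AlmostCommutativeRing; fromCommutativeRing)

private
  variable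
    A B : Set

-- Rational arithmetic and the embedding of the naturals

ℚ-ring : AlmostCommutativeRing 0ℓ 0ℓ
ℚ-ring = fromCommutativeRing ℚ.+-*-commutativeRing (λ p → dec⇒maybe (0ℚ ℚ.≟ p))

module _ where

  open import Data.Rational.Base using (_+_; _*_; _-_; _≤_)

  ⟦_⟧ : ℕ → ℚ
  ⟦ n ⟧ = + n / 1

  toℚᵘ-/ : ∀ i n .{{_ : ℕ.NonZero n}} → toℚᵘ (i / n) ℚᵘ.≃ i ℚᵘ./ n
  toℚᵘ-/ i (suc n) = ℚ.toℚᵘ-fromℚᵘ (ℚᵘ.mkℚᵘ i n)

  ⟦⟧-+ : ∀ m n → ⟦ m ℕ.+ n ⟧ ≡ ⟦ m ⟧ + ⟦ n ⟧
  ⟦⟧-+ m n = ℚ.toℚᵘ-injective (begin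
    toℚᵘ ⟦ m ℕ.+ n ⟧                 ≈⟨ toℚᵘ-/ (+ (m ℕ.+ n)) 1 ⟩
    + (m ℕ.+ n) ℚᵘ./ 1               ≈⟨ ℚᵘ.*≡* (cong (ℤ._* (+ 1)) eq) ⟩
    (+ m ℚᵘ./ 1) ℚᵘ.+ (+ n ℚᵘ./ 1)   ≈⟨ ℚᵘ.+-cong (toℚᵘ-/ (+ m) 1) (toℚᵘ-/ (+ n) 1) ⟨
    toℚᵘ ⟦ m ⟧ ℚᵘ.+ toℚᵘ ⟦ n ⟧       ≈⟨ ℚ.toℚᵘ-homo-+ ⟦ m ⟧ ⟦ n ⟧ ⟨
    toℚᵘ (⟦ m ⟧ + ⟦ n ⟧)             ∎)
    where
    open ℚᵘ.≃-Reasoning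
    eq = sym (cong₂ ℤ._+_ (ℤ.*-identityʳ (+ m)) (ℤ.*-identityʳ (+ n)))

  /≡*1/ : ∀ m n .{{_ : ℕ.NonZero n}} → + m / n ≡ ⟦ m ⟧ * (1ℤ / n)
  /≡*1/ m n@(suc n-1) = ℚ.toℚᵘ-injective (begin
    toℚᵘ (+ m / n)                    ≈⟨ toℚᵘ-/ (+ m) n ⟩
    + m ℚᵘ./ n                        ≈⟨ ℚᵘ.*≡* eq ⟩
    (+ m ℚᵘ./ 1) ℚᵘ.* (1ℤ ℚᵘ./ n)     ≈⟨ ℚᵘ.*-cong (toℚᵘ-/ (+ m) 1) (toℚᵘ-/ 1ℤ n) ⟨
    toℚᵘ ⟦ m ⟧ ℚᵘ.* toℚᵘ (1ℤ / n)     ≈⟨ ℚ.toℚᵘ-homo-* ⟦ m ⟧ (1ℤ / n) ⟨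
    toℚᵘ (⟦ m ⟧ * (1ℤ / n))           ∎)
    where
    open ℚᵘ.≃-Reasoning
    eq = cong₂ ℤ._*_ (sym (ℤ.*-identityʳ (+ m))) (cong (λ k → + suc k) (ℕ.+-identityʳ n-1))

  1/*⟦⟧ : ∀ n .{{_ : ℕ.NonZero n}} → (1ℤ / n) * ⟦ n ⟧ ≡ 1ℚ
  1/*⟦⟧ n@(suc n-1) = trans (ℚ.*-comm (1ℤ / n) ⟦ n ⟧) (trans (sym (/≡*1/ n n)) (ℚ.toℚᵘ-injective (begin
    toℚᵘ (+ n / n)   ≈⟨ toℚᵘ-/ (+ n) n ⟩
    + n ℚᵘ./ n       ≈⟨ ℚᵘ.*≡* (ℤ.*-comm (+ n) (+ 1)) ⟩
    toℚᵘ 1ℚ          ∎)))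
    where open ℚᵘ.≃-Reasoning

  /-nonNeg : ∀ m n .{{_ : ℕ.NonZero n}} → NonNegative (+ m / n)
  /-nonNeg m n = ℚ.normalize-nonNeg m n

  ⟦⟧-mono : ∀ {m n} → m ℕ.≤ n → ⟦ m ⟧ ≤ ⟦ n ⟧
  ⟦⟧-mono {m} {n} m≤n = begin
    ⟦ m ⟧                       ≡⟨ ℚ.+-identityʳ ⟦ m ⟧ ⟨
    ⟦ m ⟧ + 0ℚ                  ≤⟨ ℚ.+-monoʳ-≤ ⟦ m ⟧ (ℚ.nonNegative⁻¹ _ {{/-nonNeg (n ∸ m) 1}}) ⟩
    ⟦ m ⟧ + ⟦ n ∸ m ⟧           ≡⟨ ⟦⟧-+ m (n ∸ m) ⟨
    ⟦ m ℕ.+ (n ∸ m) ⟧           ≡⟨ cong ⟦_⟧ (ℕ.m+[n∸m]≡n m≤n) ⟩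
    ⟦ n ⟧                       ∎
    where open ℚ.≤-Reasoning

  ⟦⟧-* : ∀ m n → ⟦ m ℕ.* n ⟧ ≡ ⟦ m ⟧ * ⟦ n ⟧
  ⟦⟧-* zero    n = sym (ℚ.*-zeroˡ ⟦ n ⟧)
  ⟦⟧-* (suc m) n = begin
    ⟦ n ℕ.+ m ℕ.* n ⟧           ≡⟨ ⟦⟧-+ n (m ℕ.* n) ⟩
    ⟦ n ⟧ + ⟦ m ℕ.* n ⟧         ≡⟨ cong (λ s → ⟦ n ⟧ + s) (⟦⟧-* m n) ⟩
    ⟦ n ⟧ + ⟦ m ⟧ * ⟦ n ⟧       ≡⟨ factor ⟦ m ⟧ ⟦ n ⟧ ⟩
    (1ℚ + ⟦ m ⟧) * ⟦ n ⟧        ≡⟨ cong (_* ⟦ n ⟧) (⟦⟧-+ 1 m) ⟨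
    ⟦ suc m ⟧ * ⟦ n ⟧           ∎
    where
    open ≡-Reasoning
    factor : ∀ x y → y + x * y ≡ (1ℚ + x) * y
    factor = solve-∀ ℚ-ring

  p≤∣p∣ : ∀ p → p ≤ ∣ p ∣
  p≤∣p∣ p with ℚ.≤-total 0ℚ p
  ... | inj₁ 0≤p = ℚ.≤-reflexive (sym (ℚ.0≤p⇒∣p∣≡p 0≤p))
  ... | inj₂ p≤0 = ℚ.≤-trans p≤0 (ℚ.0≤∣p∣ p)

  ∣p∣≤q⇒p*p≤q*q : ∀ {p q} → ∣ p ∣ ≤ q → p * p ≤ q * q
  ∣p∣≤q⇒p*p≤q*q {p} {q} ∣p∣≤q = begin
    p * p             ≤⟨ p≤∣p∣ (p * p) ⟩
    ∣ p * p ∣         ≡⟨ ℚ.∣p*q∣≡∣p∣*∣q∣ p p ⟩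
    ∣ p ∣ * ∣ p ∣     ≤⟨ ℚ.*-monoˡ-≤-nonNeg ∣ p ∣ ∣p∣≤q ⟩
    ∣ p ∣ * q         ≤⟨ ℚ.*-monoʳ-≤-nonNeg q ∣p∣≤q ⟩
    q * q             ∎
    where
    open ℚ.≤-Reasoning
    instance
      _ = ℚ.∣-∣-nonNeg p
      q≥0 : NonNegative q
      q≥0 = ℚ.nonNegative (ℚ.≤-trans (ℚ.0≤∣p∣ p) ∣p∣≤q)

  -- Finite sums and counting by indicators

  ∑ : List A → (A → ℚ) → ℚ
  ∑ []       f = 0ℚ
  ∑ (x ∷ xs) f = f x + ∑ xs f

  ∑-cong : ∀ (xs : List A) {f g} → (∀ {x} → x ∈ xs → f x ≡ g x) → ∑ xs f ≡ ∑ xs g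
  ∑-cong []       f≡g = refl
  ∑-cong (x ∷ xs) f≡g = cong₂ _+_ (f≡g (here refl)) (∑-cong xs (f≡g ∘ there))

  ∑-mono : ∀ (xs : List A) {f g} → (∀ {x} → x ∈ xs → f x ≤ g x) → ∑ xs f ≤ ∑ xs g
  ∑-mono []       f≤g = ℚ.≤-refl
  ∑-mono (x ∷ xs) f≤g = ℚ.+-mono-≤ (f≤g (here refl)) (∑-mono xs (f≤g ∘ there))

  ∑-const : ∀ (xs : List A) c → ∑ xs (λ _ → c) ≡ ⟦ length xs ⟧ * c
  ∑-const []       c = sym (ℚ.*-zeroˡ c)
  ∑-const (x ∷ xs) c = begin
    c + ∑ xs (λ _ → c)              ≡⟨ cong (λ s → c + s) (∑-const xs c) ⟩
    c + ⟦ length xs ⟧ * c           ≡⟨ factor ⟦ length xs ⟧ c ⟩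
    (1ℚ + ⟦ length xs ⟧) * c        ≡⟨ cong (_* c) (⟦⟧-+ 1 (length xs)) ⟨
    ⟦ suc (length xs) ⟧ * c         ∎
    where
    open ≡-Reasoning
    factor : ∀ x y → y + x * y ≡ (1ℚ + x) * y
    factor = solve-∀ ℚ-ring

  ∑-insert : ∀ (ys : List A) v zs f → ∑ (ys ++ v ∷ zs) f ≡ f v + ∑ (ys ++ zs) f
  ∑-insert []       v zs f = refl
  ∑-insert (y ∷ ys) v zs f = trans (cong (λ s → f y + s) (∑-insert ys v zs f)) (swap (f y) (f v) (∑ (ys ++ zs) f))
    where
    swap : ∀ a b c → a + (b + c) ≡ b + (a + c)
    swap = solve-∀ ℚ-ring

  ∣∑-∑∣≤ : ∀ (xs : List A) f g → ∣ ∑ xs f - ∑ xs g ∣ ≤ ∑ xs (λ x → ∣ f x - g x ∣)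
  ∣∑-∑∣≤ []       f g = ℚ.≤-refl
  ∣∑-∑∣≤ (x ∷ xs) f g = begin
    ∣ (f x + ∑ xs f) - (g x + ∑ xs g) ∣          ≡⟨ cong ∣_∣ (regroup (f x) (∑ xs f) (g x) (∑ xs g)) ⟩
    ∣ (f x - g x) + (∑ xs f - ∑ xs g) ∣          ≤⟨ ℚ.∣p+q∣≤∣p∣+∣q∣ (f x - g x) (∑ xs f - ∑ xs g) ⟩
    ∣ f x - g x ∣ + ∣ ∑ xs f - ∑ xs g ∣          ≤⟨ ℚ.+-monoʳ-≤ ∣ f x - g x ∣ (∣∑-∑∣≤ xs f g) ⟩
    ∣ f x - g x ∣ + ∑ xs (λ x → ∣ f x - g x ∣)   ∎
    where
    open ℚ.≤-Reasoning
    regroup : ∀ a b c d → (a + b) - (c + d) ≡ (a - c) + (b - d)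
    regroup = solve-∀ ℚ-ring

  indicator : ∀ {P : Set} → Dec P → ℚ
  indicator P? = if does P? then 1ℚ else 0ℚ

  ∑-indicator : ∀ {P : Unary.Pred A 0ℓ} (P? : Unary.Decidable P) xs →
                ∑ xs (indicator ∘ P?) ≡ ⟦ length (filter P? xs) ⟧
  ∑-indicator P? []       = refl
  ∑-indicator P? (x ∷ xs) with does (P? x)
  ... | true  = trans (cong (λ s → 1ℚ + s) (∑-indicator P? xs)) (sym (⟦⟧-+ 1 (length (filter P? xs))))
  ... | false = trans (ℚ.+-identityˡ (∑ xs (indicator ∘ P?))) (∑-indicator P? xs)

  length-filter-complement : ∀ {P : Unary.Pred A 0ℓ} (P? : Unary.Decidable P) xs →
                             length xs ≡ length (filter P? xs) ℕ.+ length (filter (¬? ∘ P?) xs)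
  length-filter-complement P? []       = refl
  length-filter-complement P? (x ∷ xs) with does (P? x)
  ... | true  = cong suc (length-filter-complement P? xs)
  ... | false = trans (cong suc (length-filter-complement P? xs)) (sym (ℕ.+-suc (length (filter P? xs)) _))

  -- Expectation and variance of finite distributions

  𝔼-cong : ∀ (d : Dist A) {X Y} → (∀ a → X a ≡ Y a) → 𝔼 d X ≡ 𝔼 d Y
  𝔼-cong []            X≡Y = refl
  𝔼-cong ((p , a) ∷ d) X≡Y = cong₂ (λ x s → p * x + s) (X≡Y a) (𝔼-cong d X≡Y)

  𝔼-+ : ∀ (d : Dist A) X Y → 𝔼 d (λ a → X a + Y a) ≡ 𝔼 d X + 𝔼 d Y
  𝔼-+ []            X Y = refl
  𝔼-+ ((p , a) ∷ d) X Y =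
    trans (cong (λ s → p * (X a + Y a) + s) (𝔼-+ d X Y)) (regroup p (X a) (Y a) (𝔼 d X) (𝔼 d Y))
    where
    regroup : ∀ p x y s t → p * (x + y) + (s + t) ≡ (p * x + s) + (p * y + t)
    regroup = solve-∀ ℚ-ring

  𝔼-* : ∀ (d : Dist A) c X → 𝔼 d (λ a → c * X a) ≡ c * 𝔼 d X
  𝔼-* []            c X = sym (ℚ.*-zeroʳ c)
  𝔼-* ((p , a) ∷ d) c X = trans (cong (λ s → p * (c * X a) + s) (𝔼-* d c X)) (regroup p c (X a) (𝔼 d X))
    where
    regroup : ∀ p c x s → p * (c * x) + c * s ≡ c * (p * x + s)
    regroup = solve-∀ ℚ-ring

  𝔼-++ : ∀ (d e : Dist A) X → 𝔼 (d ++ e) X ≡ 𝔼 d X + 𝔼 e X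
  𝔼-++ []            e X = sym (ℚ.+-identityˡ (𝔼 e X))
  𝔼-++ ((p , a) ∷ d) e X =
    trans (cong (λ s → p * X a + s) (𝔼-++ d e X)) (sym (ℚ.+-assoc (p * X a) (𝔼 d X) (𝔼 e X)))

  𝔼-scale : ∀ p (d : Dist A) X → 𝔼 (map (map₁ (p *_)) d) X ≡ p * 𝔼 d X
  𝔼-scale p []            X = sym (ℚ.*-zeroʳ p)
  𝔼-scale p ((q , a) ∷ d) X =
    trans (cong (λ s → p * q * X a + s) (𝔼-scale p d X)) (regroup p q (X a) (𝔼 d X))
    where
    regroup : ∀ p q x s → p * q * x + p * s ≡ p * (q * x + s)
    regroup = solve-∀ ℚ-ring

  𝔼->>= : ∀ (d : Dist A) (k : A → Dist B) X → 𝔼 (d >>= k) X ≡ 𝔼 d (λ a → 𝔼 (k a) X)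
  𝔼->>= []            k X = refl
  𝔼->>= ((p , a) ∷ d) k X =
    trans (𝔼-++ (map (map₁ (p *_)) (k a)) (d >>= k) X) (cong₂ _+_ (𝔼-scale p (k a) X) (𝔼->>= d k X))

  𝔼-pure : ∀ (a : A) X → 𝔼 (pure a) X ≡ X a
  𝔼-pure a X = trans (ℚ.+-identityʳ (1ℚ * X a)) (ℚ.*-identityˡ (X a))

  𝔼-uniform : ∀ (x : A) xs X → 𝔼 (uniform (x ∷ xs)) X ≡ (1ℤ / length (x ∷ xs)) * ∑ (x ∷ xs) X
  𝔼-uniform x xs X = weighted (1ℤ / length (x ∷ xs)) (x ∷ xs)
    where
    weighted : ∀ w ys → 𝔼 (map (w ,_) ys) X ≡ w * ∑ ys X
    weighted w []       = sym (ℚ.*-zeroʳ w)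
    weighted w (y ∷ ys) = trans (cong (λ s → w * X y + s) (weighted w ys)) (sym (ℚ.*-distribˡ-+ w (X y) (∑ ys X)))

  -- Clears the denominator, so that first-pick recursions on lists of different lengths can be
  -- compared as plain sums.
  length*𝔼-uniform : ∀ (x : A) xs X → ⟦ length (x ∷ xs) ⟧ * 𝔼 (uniform (x ∷ xs)) X ≡ ∑ (x ∷ xs) X
  length*𝔼-uniform x xs X = begin
    n * 𝔼 (uniform (x ∷ xs)) X    ≡⟨ cong (n *_) (𝔼-uniform x xs X) ⟩
    n * (1/n * s)                 ≡⟨ regroup n 1/n s ⟩
    1/n * n * s                   ≡⟨ cong (_* s) (1/*⟦⟧ (length (x ∷ xs))) ⟩
    1ℚ * s                        ≡⟨ ℚ.*-identityˡ s ⟩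
    s                             ∎
    where
    open ≡-Reasoning
    n   = ⟦ length (x ∷ xs) ⟧
    1/n = 1ℤ / length (x ∷ xs)
    s   = ∑ (x ∷ xs) X
    regroup : ∀ a b c → a * (b * c) ≡ b * a * c
    regroup = solve-∀ ℚ-ring

  -- Agreement is asked only on listed items, because a pick is known to shorten the list only if it
  -- belongs to it.
  𝔼-uniform-cong : ∀ (xs : List A) {X Y} → (∀ {x} → x ∈ xs → X x ≡ Y x) → 𝔼 (uniform xs) X ≡ 𝔼 (uniform xs) Y
  𝔼-uniform-cong []       X≡Y = refl
  𝔼-uniform-cong (x ∷ xs) {X} {Y} X≡Y =
    trans (𝔼-uniform x xs X)
   (trans (cong ((1ℤ / length (x ∷ xs)) *_) (∑-cong (x ∷ xs) X≡Y)) (sym (𝔼-uniform x xs Y)))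

  𝔼-uniform-const : ∀ (x : A) xs c → 𝔼 (uniform (x ∷ xs)) (λ _ → c) ≡ c
  𝔼-uniform-const x xs c = begin
    𝔼 (uniform (x ∷ xs)) (λ _ → c)    ≡⟨ 𝔼-uniform x xs (λ _ → c) ⟩
    1/n * ∑ (x ∷ xs) (λ _ → c)        ≡⟨ cong (1/n *_) (∑-const (x ∷ xs) c) ⟩
    1/n * (n * c)                     ≡⟨ ℚ.*-assoc 1/n n c ⟨
    1/n * n * c                       ≡⟨ cong (_* c) (1/*⟦⟧ (length (x ∷ xs))) ⟩
    1ℚ * c                            ≡⟨ ℚ.*-identityˡ c ⟩
    c                                 ∎
    where
    open ≡-Reasoning
    n   = ⟦ length (x ∷ xs) ⟧
    1/n = 1ℤ / length (x ∷ xs)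

  𝔼-uniform-mono : ∀ (xs : List A) {X Y} → (∀ {x} → x ∈ xs → X x ≤ Y x) → 𝔼 (uniform xs) X ≤ 𝔼 (uniform xs) Y
  𝔼-uniform-mono []       X≤Y = ℚ.≤-refl
  𝔼-uniform-mono (x ∷ xs) {X} {Y} X≤Y = begin
    𝔼 (uniform (x ∷ xs)) X                      ≡⟨ 𝔼-uniform x xs X ⟩
    (1ℤ / length (x ∷ xs)) * ∑ (x ∷ xs) X       ≤⟨ ℚ.*-monoˡ-≤-nonNeg (1ℤ / length (x ∷ xs)) {{/-nonNeg 1 (length (x ∷ xs))}} (∑-mono (x ∷ xs) X≤Y) ⟩
    (1ℤ / length (x ∷ xs)) * ∑ (x ∷ xs) Y       ≡⟨ 𝔼-uniform x xs Y ⟨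
    𝔼 (uniform (x ∷ xs)) Y                      ∎
    where open ℚ.≤-Reasoning

  -- Expanding around the mean μ, the cross term 2(μ - b)(X - μ) averages to zero. A `Dist` may
  -- carry arbitrary weights, so total mass 1 is a hypothesis.
  𝔼-shifted-square : ∀ (d : Dist A) X b → 𝔼 d (λ _ → 1ℚ) ≡ 1ℚ →
                     𝔼 d (λ a → (X a - b) * (X a - b)) ≡ Var d X + (𝔼 d X - b) * (𝔼 d X - b)
  𝔼-shifted-square d X b mass = begin
    𝔼 d (λ a → (X a - b) * (X a - b))
      ≡⟨ 𝔼-cong d (λ a → expand (X a) b μ) ⟩
    𝔼 d (λ a → (X a - μ) * (X a - μ) + (s * X a + t * 1ℚ))
      ≡⟨ 𝔼-+ d (λ a → (X a - μ) * (X a - μ)) (λ a → s * X a + t * 1ℚ) ⟩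
    Var d X + 𝔼 d (λ a → s * X a + t * 1ℚ)
      ≡⟨ cong (λ s → Var d X + s) (𝔼-+ d (λ a → s * X a) (λ _ → t * 1ℚ)) ⟩
    Var d X + (𝔼 d (λ a → s * X a) + 𝔼 d (λ _ → t * 1ℚ))
      ≡⟨ cong (λ s → Var d X + s) (cong₂ _+_ (𝔼-* d s X) (trans (𝔼-* d t (λ _ → 1ℚ)) (cong (t *_) mass))) ⟩
    Var d X + (s * μ + t * 1ℚ)
      ≡⟨ cong (λ s → Var d X + s) (collect μ b) ⟩
    Var d X + (μ - b) * (μ - b)
      ∎
    where
    open ≡-Reasoning
    μ = 𝔼 d X
    -- The difference (X - b)² - (X - μ)² is affine in X, with slope `s` and constant `t`. The
    -- constant is written `t * 1ℚ` so that `mass` evaluates its mean.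
    s = (μ - b) + (μ - b)
    t = (μ - b) * (μ - b) - ((μ - b) + (μ - b)) * μ
    expand : ∀ x b m → (x - b) * (x - b) ≡
             (x - m) * (x - m) + (((m - b) + (m - b)) * x + ((m - b) * (m - b) - ((m - b) + (m - b)) * m) * 1ℚ)
    expand = solve-∀ ℚ-ring
    collect : ∀ m b → ((m - b) + (m - b)) * m + ((m - b) * (m - b) - ((m - b) + (m - b)) * m) * 1ℚ ≡ (m - b) * (m - b)
    collect = solve-∀ ℚ-ring

  Var-cong : ∀ (d : Dist A) {X Y} → (∀ a → X a ≡ Y a) → Var d X ≡ Var d Y
  Var-cong d X≡Y = 𝔼-cong d λ a → cong₂ (λ x m → (x - m) * (x - m)) (X≡Y a) (𝔼-cong d X≡Y)

  Var-* : ∀ (d : Dist A) X c → Var d (λ a → X a * c) ≡ c * c * Var d X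
  Var-* d X c = begin
    𝔼 d (λ a → (X a * c - ν) * (X a * c - ν))
      ≡⟨ cong (λ ν → 𝔼 d (λ a → (X a * c - ν) * (X a * c - ν))) ν≡cμ ⟩
    𝔼 d (λ a → (X a * c - c * μ) * (X a * c - c * μ))
      ≡⟨ 𝔼-cong d (λ a → factor (X a) c μ) ⟩
    𝔼 d (λ a → c * c * ((X a - μ) * (X a - μ)))
      ≡⟨ 𝔼-* d (c * c) (λ a → (X a - μ) * (X a - μ)) ⟩
    c * c * Var d X
      ∎
    where
    open ≡-Reasoning
    μ = 𝔼 d X
    ν = 𝔼 d (λ a → X a * c)
    ν≡cμ : ν ≡ c * μ
    ν≡cμ = trans (𝔼-cong d (λ a → ℚ.*-comm (X a) c)) (𝔼-* d c X)
    factor : ∀ x c m → (x * c - c * m) * (x * c - c * m) ≡ c * c * ((x - m) * (x - m))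
    factor = solve-∀ ℚ-ring

  -- Greedy on a conflict relation and its first-pick recursion

  module Greedy {_#_ : Rel A 0ℓ} (_#?_ : Decidable _#_) (#-refl : Reflexive _#_) (#-sym : Symmetric _#_) where

    infixl 6 _∖_

    -- Spelled exactly as the filter in `greedySteps`, so that the recursive call there is by
    -- definition a run on `xs ∖ x`.
    _∖_ : List A → A → List A
    xs ∖ x = filter (λ y → ¬? (x #? y)) xs

    steps : ℕ → List A → Dist (List A)
    steps = greedySteps _#?_

    size : List A → ℚ
    size S = ⟦ length S ⟧

    mean : ℕ → List A → ℚ
    mean k xs = 𝔼 (steps k xs) size

    -- The function e of the proof idea. Fixing the fuel at the length makes it depend on the list
    -- alone.
    expected : List A → ℚ
    expected xs = mean (length xs) xs

    -- Strict because conflict is reflexive: the picked item deletes itself.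
    length-∖ : ∀ {x xs} → x ∈ xs → length (xs ∖ x) ℕ.< length xs
    length-∖ {x} {xs} x∈xs = List.filter-notAll (λ y → ¬? (x #? y)) xs
      (Any.map (λ {refl ¬x#x → ¬x#x #-refl}) x∈xs)

    length-∖-≤ : ∀ {k x xs} → x ∈ xs → length xs ℕ.≤ suc k → length (xs ∖ x) ℕ.≤ k
    length-∖-≤ x∈xs xs≤k = ℕ.s≤s⁻¹ (ℕ.≤-trans (length-∖ x∈xs) xs≤k)

    -- Conditioning on the first pick, for an arbitrary function of the output: the size gives the
    -- recursion for the mean, its squared deviation the one for the variance.
    𝔼-steps : ∀ k x xs X →
      𝔼 (steps (suc k) (x ∷ xs)) X ≡ 𝔼 (uniform (x ∷ xs)) (λ y → 𝔼 (steps k ((x ∷ xs) ∖ y)) (λ S → X (y ∷ S)))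
    𝔼-steps k x xs X =
      trans (𝔼->>= (uniform (x ∷ xs)) (λ y → steps k ((x ∷ xs) ∖ y) >>= λ S → pure (y ∷ S)) X)
            (𝔼-cong (uniform (x ∷ xs)) λ y →
              trans (𝔼->>= (steps k ((x ∷ xs) ∖ y)) (λ S → pure (y ∷ S)) X)
                    (𝔼-cong (steps k ((x ∷ xs) ∖ y)) λ S → 𝔼-pure (y ∷ S) X))

    steps-mass : ∀ k xs → 𝔼 (steps k xs) (λ _ → 1ℚ) ≡ 1ℚ
    steps-mass zero    xs       = refl
    steps-mass (suc k) []       = refl
    steps-mass (suc k) (x ∷ xs) =
      trans (𝔼-steps k x xs (λ _ → 1ℚ))
     (trans (𝔼-cong (uniform (x ∷ xs)) (λ y → steps-mass k ((x ∷ xs) ∖ y)))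
            (𝔼-uniform-const x xs 1ℚ))

    mean-suc : ∀ k x xs → mean (suc k) (x ∷ xs) ≡ 𝔼 (uniform (x ∷ xs)) (λ y → 1ℚ + mean k ((x ∷ xs) ∖ y))
    mean-suc k x xs = trans (𝔼-steps k x xs size) (𝔼-cong (uniform (x ∷ xs)) step)
      where
      step : ∀ y → 𝔼 (steps k ((x ∷ xs) ∖ y)) (λ S → size (y ∷ S)) ≡ 1ℚ + mean k ((x ∷ xs) ∖ y)
      step y = begin
        𝔼 d (λ S → size (y ∷ S))              ≡⟨ 𝔼-cong d (λ S → ⟦⟧-+ 1 (length S)) ⟩
        𝔼 d (λ S → 1ℚ + size S)               ≡⟨ 𝔼-+ d (λ _ → 1ℚ) size ⟩
        𝔼 d (λ _ → 1ℚ) + 𝔼 d size             ≡⟨ cong (_+ 𝔼 d size) (steps-mass k ((x ∷ xs) ∖ y)) ⟩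
        1ℚ + 𝔼 d size                         ∎
        where
        open ≡-Reasoning
        d = steps k ((x ∷ xs) ∖ y)

    -- Every pick strictly shortens the list, so fuel beyond its length is never consumed.
    mean-fuel : ∀ k l xs → length xs ℕ.≤ k → length xs ℕ.≤ l → mean k xs ≡ mean l xs
    mean-fuel zero    zero    []       _    _    = refl
    mean-fuel zero    (suc l) []       _    _    = refl
    mean-fuel (suc k) zero    []       _    _    = refl
    mean-fuel (suc k) (suc l) []       _    _    = refl
    mean-fuel (suc k) (suc l) (x ∷ xs) xs≤k xs≤l = begin
      mean (suc k) (x ∷ xs)
        ≡⟨ mean-suc k x xs ⟩
      𝔼 (uniform (x ∷ xs)) (λ y → 1ℚ + mean k ((x ∷ xs) ∖ y))
        ≡⟨ 𝔼-uniform-cong (x ∷ xs) (λ {y} y∈ → cong (λ s → 1ℚ + s)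
             (mean-fuel k l ((x ∷ xs) ∖ y) (length-∖-≤ y∈ xs≤k) (length-∖-≤ y∈ xs≤l))) ⟩
      𝔼 (uniform (x ∷ xs)) (λ y → 1ℚ + mean l ((x ∷ xs) ∖ y))
        ≡⟨ mean-suc l x xs ⟨
      mean (suc l) (x ∷ xs)
        ∎
      where open ≡-Reasoning

    mean≡expected : ∀ {k} xs → length xs ℕ.≤ k → mean k xs ≡ expected xs
    mean≡expected {k} xs xs≤k = mean-fuel k (length xs) xs xs≤k ℕ.≤-refl

    length*expected : ∀ xs → ⟦ length xs ⟧ * expected xs ≡ ∑ xs (λ x → 1ℚ + expected (xs ∖ x))
    length*expected []           = refl
    length*expected xs@(x ∷ xs′) = begin
      ⟦ length xs ⟧ * expected xs
        ≡⟨ cong (⟦ length xs ⟧ *_) (mean-suc (length xs′) x xs′) ⟩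
      ⟦ length xs ⟧ * 𝔼 (uniform xs) (λ y → 1ℚ + mean (length xs′) (xs ∖ y))
        ≡⟨ length*𝔼-uniform x xs′ (λ y → 1ℚ + mean (length xs′) (xs ∖ y)) ⟩
      ∑ xs (λ y → 1ℚ + mean (length xs′) (xs ∖ y))
        ≡⟨ ∑-cong xs (λ {y} y∈ → cong (λ s → 1ℚ + s) (mean≡expected (xs ∖ y) (length-∖-≤ y∈ ℕ.≤-refl))) ⟩
      ∑ xs (λ y → 1ℚ + expected (xs ∖ y))
        ∎
      where open ≡-Reasoning

    -- Sensitivity of the expected size to deleting items

    InsertLipschitz : ℕ → Set
    InsertLipschitz k = ∀ ys v zs → length (ys ++ v ∷ zs) ℕ.≤ k →
                        ∣ expected (ys ++ v ∷ zs) - expected (ys ++ zs) ∣ ≤ 1ℚ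

    -- Telescoping: the items missing from `zs` are dropped one at a time, and `ps` collects the
    -- shared items already passed. The one-item bound is a hypothesis because its own inductive
    -- proof uses this telescoped form on shorter lists.
    insert⇒⊆-Lipschitz : ∀ {k} → InsertLipschitz k → ∀ ps {zs xs} → zs ⊆ xs → length (ps ++ xs) ℕ.≤ k →
                         ∣ expected (ps ++ xs) - expected (ps ++ zs) ∣ ≤ ⟦ length xs ⟧ - ⟦ length zs ⟧
    insert⇒⊆-Lipschitz lip ps [] _ = ℚ.≤-reflexive (cong ∣_∣ (ℚ.+-inverseʳ (expected (ps ++ []))))
    insert⇒⊆-Lipschitz {k} lip ps {zs} {x ∷ xs} (x ∷ʳ zs⊆xs) ≤k = begin
      ∣ a - c ∣
        ≡⟨ cong ∣_∣ (split a b c) ⟩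
      ∣ (a - b) + (b - c) ∣
        ≤⟨ ℚ.∣p+q∣≤∣p∣+∣q∣ (a - b) (b - c) ⟩
      ∣ a - b ∣ + ∣ b - c ∣
        ≤⟨ ℚ.+-mono-≤ (lip ps x xs ≤k) (insert⇒⊆-Lipschitz lip ps zs⊆xs (ℕ.≤-trans shorter ≤k)) ⟩
      1ℚ + (⟦ length xs ⟧ - ⟦ length zs ⟧)
        ≡⟨ ℚ.+-assoc 1ℚ ⟦ length xs ⟧ (ℚ.- ⟦ length zs ⟧) ⟨
      (1ℚ + ⟦ length xs ⟧) - ⟦ length zs ⟧
        ≡⟨ cong (_- ⟦ length zs ⟧) (⟦⟧-+ 1 (length xs)) ⟨
      ⟦ length (x ∷ xs) ⟧ - ⟦ length zs ⟧
        ∎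
      where
      open ℚ.≤-Reasoning
      a = expected (ps ++ x ∷ xs)
      b = expected (ps ++ xs)
      c = expected (ps ++ zs)
      split : ∀ a b c → a - c ≡ (a - b) + (b - c)
      split = solve-∀ ℚ-ring
      shorter : length (ps ++ xs) ℕ.≤ length (ps ++ x ∷ xs)
      shorter = subst (length (ps ++ xs) ℕ.≤_) (sym (List.length-++-sucʳ ps x xs)) (ℕ.n≤1+n _)
    insert⇒⊆-Lipschitz {k} lip ps {x ∷ zs} {x ∷ xs} (refl ∷ zs⊆xs) ≤k = begin
      ∣ expected (ps ++ x ∷ xs) - expected (ps ++ x ∷ zs) ∣
        ≡⟨ cong₂ (λ s t → ∣ expected s - expected t ∣) (List.++-assoc ps [ x ] xs) (List.++-assoc ps [ x ] zs) ⟨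
      ∣ expected ((ps ++ [ x ]) ++ xs) - expected ((ps ++ [ x ]) ++ zs) ∣
        ≤⟨ insert⇒⊆-Lipschitz lip (ps ++ [ x ]) zs⊆xs
             (subst (λ s → length s ℕ.≤ k) (sym (List.++-assoc ps [ x ] xs)) ≤k) ⟩
      ⟦ length xs ⟧ - ⟦ length zs ⟧
        ≡⟨ cancel ⟦ length xs ⟧ ⟦ length zs ⟧ ⟩
      (1ℚ + ⟦ length xs ⟧) - (1ℚ + ⟦ length zs ⟧)
        ≡⟨ cong₂ _-_ (⟦⟧-+ 1 (length xs)) (⟦⟧-+ 1 (length zs)) ⟨
      ⟦ length (x ∷ xs) ⟧ - ⟦ length (x ∷ zs) ⟧
        ∎
      where
      open ℚ.≤-Reasoning
      cancel : ∀ a b → a - b ≡ (1ℚ + a) - (1ℚ + b)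
      cancel = solve-∀ ℚ-ring

    insert-Lipschitz : ∀ k → InsertLipschitz k
    insert-Lipschitz zero    ys v zs ≤0   = contradiction
      (subst (ℕ._≤ 0) (List.length-++-sucʳ ys v zs) ≤0) λ ()
    -- The bound is proved after multiplication by the length of `H`, the form in which the
    -- first-pick recursion holds.
    insert-Lipschitz (suc k) ys v zs ≤1+k = ℚ.*-cancelˡ-≤-pos ⟦ length H ⟧ {{⟦H⟧>0}} (begin
      ⟦ length H ⟧ * ∣ expected H - expected H′ ∣
        ≡⟨ cong (_* ∣ expected H - expected H′ ∣) (ℚ.0≤p⇒∣p∣≡p (ℚ.<⇒≤ (ℚ.positive⁻¹ ⟦ length H ⟧ {{⟦H⟧>0}}))) ⟨
      ∣ ⟦ length H ⟧ ∣ * ∣ expected H - expected H′ ∣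
        ≡⟨ ℚ.∣p*q∣≡∣p∣*∣q∣ ⟦ length H ⟧ (expected H - expected H′) ⟨
      ∣ ⟦ length H ⟧ * (expected H - expected H′) ∣
        ≡⟨ cong ∣_∣ recurrence ⟩
      ∣ (f v - expected H′) + (∑ H′ f - ∑ H′ g) ∣
        ≤⟨ ℚ.∣p+q∣≤∣p∣+∣q∣ (f v - expected H′) (∑ H′ f - ∑ H′ g) ⟩
      ∣ f v - expected H′ ∣ + ∣ ∑ H′ f - ∑ H′ g ∣
        ≤⟨ ℚ.+-mono-≤ first (ℚ.≤-trans (∣∑-∑∣≤ H′ f g) rest) ⟩
      (1ℚ + (⟦ length H′ ⟧ - ⟦ length (H′ ∖ v) ⟧)) + ⟦ length (H′ ∖ v) ⟧
        ≡⟨ cancel ⟦ length H′ ⟧ ⟦ length (H′ ∖ v) ⟧ ⟩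
      1ℚ + ⟦ length H′ ⟧
        ≡⟨ ⟦H⟧≡1+⟦H′⟧ ⟨
      ⟦ length H ⟧
        ≡⟨ ℚ.*-identityʳ ⟦ length H ⟧ ⟨
      ⟦ length H ⟧ * 1ℚ
        ∎)
      where
      open ℚ.≤-Reasoning
      H  = ys ++ v ∷ zs
      H′ = ys ++ zs
      f g : A → ℚ
      f x = 1ℚ + expected (H ∖ x)
      g x = 1ℚ + expected (H′ ∖ x)
      H≡1+H′ : length H ≡ suc (length H′)
      H≡1+H′ = List.length-++-sucʳ ys v zs
      H′≤k : length H′ ℕ.≤ k
      H′≤k = ℕ.s≤s⁻¹ (subst (ℕ._≤ suc k) H≡1+H′ ≤1+k)
      ⟦H⟧≡1+⟦H′⟧ : ⟦ length H ⟧ ≡ 1ℚ + ⟦ length H′ ⟧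
      ⟦H⟧≡1+⟦H′⟧ = trans (cong ⟦_⟧ H≡1+H′) (⟦⟧-+ 1 (length H′))
      ⟦H⟧>0 : Positive ⟦ length H ⟧
      ⟦H⟧>0 = subst Positive (sym ⟦H⟧≡1+⟦H′⟧) (ℚ.pos+nonNeg⇒pos 1ℚ ⟦ length H′ ⟧ {{/-nonNeg (length H′) 1}})

      cancel : ∀ a b → (1ℚ + (a - b)) + b ≡ 1ℚ + a
      cancel = solve-∀ ℚ-ring

      recurrence : ⟦ length H ⟧ * (expected H - expected H′) ≡ (f v - expected H′) + (∑ H′ f - ∑ H′ g)
      recurrence = begin-equality
        ⟦ length H ⟧ * (expected H - expected H′)
          ≡⟨ distrib ⟦ length H ⟧ (expected H) (expected H′) ⟩
        ⟦ length H ⟧ * expected H - ⟦ length H ⟧ * expected H′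
          -- The factor in front of `expected H′` is split as 1 plus the length of `H′`: one copy is
          -- set against the pick of v, the others against the recursion for `H′`.
          ≡⟨ cong₂ (λ s t → s - t * expected H′) (trans (length*expected H) (∑-insert ys v zs f)) ⟦H⟧≡1+⟦H′⟧ ⟩
        (f v + ∑ H′ f) - (1ℚ + ⟦ length H′ ⟧) * expected H′
          ≡⟨ regroup (f v) (∑ H′ f) ⟦ length H′ ⟧ (expected H′) ⟩
        (f v - expected H′) + (∑ H′ f - ⟦ length H′ ⟧ * expected H′)
          ≡⟨ cong (λ s → (f v - expected H′) + (∑ H′ f - s)) (length*expected H′) ⟩
        (f v - expected H′) + (∑ H′ f - ∑ H′ g)
          ∎
        where
        distrib : ∀ n a b → n * (a - b) ≡ n * a - n * b
        distrib = solve-∀ ℚ-ring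
        regroup : ∀ a s n b → (a + s) - (1ℚ + n) * b ≡ (a - b) + (s - n * b)
        regroup = solve-∀ ℚ-ring

      -- A pick in conflict with v deletes v, so its presence leaves no trace.
      H∖-conflicting : ∀ {x} → x # v → H ∖ x ≡ H′ ∖ x
      H∖-conflicting {x} x#v =
        trans (List.filter-++ ¬x#? ys (v ∷ zs))
       (trans (cong (ys ∖ x ++_) (List.filter-reject ¬x#? (λ ¬x#v → ¬x#v x#v)))
              (sym (List.filter-++ ¬x#? ys zs)))
        where ¬x#? = λ y → ¬? (x #? y)

      -- Picking v leaves `H′ ∖ v`, which differs from `H′` only by the items in conflict with v.
      -- Each of them costs at most 1 by induction, and the pick itself contributes 1.
      first : ∣ f v - expected H′ ∣ ≤ 1ℚ + (⟦ length H′ ⟧ - ⟦ length (H′ ∖ v) ⟧)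
      first = begin
        ∣ f v - expected H′ ∣
          ≡⟨ cong (λ s → ∣ 1ℚ + expected s - expected H′ ∣) (H∖-conflicting #-refl) ⟩
        ∣ 1ℚ + expected (H′ ∖ v) - expected H′ ∣
          ≡⟨ cong ∣_∣ (regroup (expected (H′ ∖ v)) (expected H′)) ⟩
        ∣ 1ℚ - (expected H′ - expected (H′ ∖ v)) ∣
          ≤⟨ ℚ.∣p-q∣≤∣p∣+∣q∣ 1ℚ (expected H′ - expected (H′ ∖ v)) ⟩
        1ℚ + ∣ expected H′ - expected (H′ ∖ v) ∣
          ≤⟨ ℚ.+-monoʳ-≤ 1ℚ (insert⇒⊆-Lipschitz (insert-Lipschitz k) [] (Sublist.filter-⊆ (λ y → ¬? (v #? y)) H′) H′≤k) ⟩
        1ℚ + (⟦ length H′ ⟧ - ⟦ length (H′ ∖ v) ⟧)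
          ∎
        where
        regroup : ∀ a b → 1ℚ + a - b ≡ 1ℚ - (b - a)
        regroup = solve-∀ ℚ-ring

      ¬#v? = λ x → ¬? (x #? v)

      -- If x conflicts with v, both remaining lists coincide. Otherwise v survives the pick, and
      -- `H ∖ x` is `H′ ∖ x` with v inserted: a shorter list, covered by induction.
      difference : ∀ {x} → x ∈ H′ → ∣ f x - g x ∣ ≤ indicator (¬#v? x)
      difference {x} x∈H′ with x #? v
      ... | yes x#v = ℚ.≤-reflexive (cong ∣_∣
              (trans (cong (λ s → 1ℚ + expected s - g x) (H∖-conflicting x#v)) (ℚ.+-inverseʳ (g x))))
      ... | no ¬x#v = begin
        ∣ f x - g x ∣
          ≡⟨ cong ∣_∣ (cancel₁ (expected (H ∖ x)) (expected (H′ ∖ x))) ⟩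
        ∣ expected (H ∖ x) - expected (H′ ∖ x) ∣
          ≡⟨ cong₂ (λ s t → ∣ expected s - expected t ∣) H∖x≡ (List.filter-++ ¬x#? ys zs) ⟩
        ∣ expected ((ys ∖ x) ++ v ∷ (zs ∖ x)) - expected ((ys ∖ x) ++ (zs ∖ x)) ∣
          ≤⟨ insert-Lipschitz k (ys ∖ x) v (zs ∖ x) (subst (λ s → length s ℕ.≤ k) H∖x≡ (length-∖-≤ x∈H ≤1+k)) ⟩
        1ℚ
          ∎
        where
        ¬x#? = λ y → ¬? (x #? y)
        cancel₁ : ∀ a b → (1ℚ + a) - (1ℚ + b) ≡ a - b
        cancel₁ = solve-∀ ℚ-ring
        H∖x≡ : H ∖ x ≡ (ys ∖ x) ++ v ∷ (zs ∖ x)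
        H∖x≡ = trans (List.filter-++ ¬x#? ys (v ∷ zs)) (cong (ys ∖ x ++_) (List.filter-accept ¬x#? ¬x#v))
        x∈H : x ∈ H
        x∈H = [ ∈-++⁺ˡ , ∈-++⁺ʳ ys ∘ there ]′ (∈-++⁻ ys x∈H′)

      rest : ∑ H′ (λ x → ∣ f x - g x ∣) ≤ ⟦ length (H′ ∖ v) ⟧
      rest = begin
        ∑ H′ (λ x → ∣ f x - g x ∣)      ≤⟨ ∑-mono H′ difference ⟩
        ∑ H′ (indicator ∘ ¬#v?)         ≡⟨ ∑-indicator ¬#v? H′ ⟩
        -- Symmetry of conflict turns this count into the length of `H′ ∖ v`, which cancels against
        -- the term subtracted in `first`.
        ⟦ length (filter ¬#v? H′) ⟧     ≡⟨ cong (⟦_⟧ ∘ length) (List.filter-≐ ¬#v? (λ y → ¬? (v #? y)) ((_∘ #-sym) , (_∘ #-sym)) H′) ⟩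
        ⟦ length (H′ ∖ v) ⟧             ∎

    ⊆-Lipschitz : ∀ {zs xs} → zs ⊆ xs → ∣ expected xs - expected zs ∣ ≤ ⟦ length xs ⟧ - ⟦ length zs ⟧
    ⊆-Lipschitz {xs = xs} zs⊆xs = insert⇒⊆-Lipschitz (insert-Lipschitz (length xs)) [] zs⊆xs ℕ.≤-refl

    -- Variance bound from bounded martingale differences

    ConflictsBounded : ℕ → List A → Set
    ConflictsBounded D xs = ∀ x → length (filter (x #?_) xs) ℕ.≤ D

    ConflictsBounded-⊆ : ∀ {D zs xs} → zs ⊆ xs → ConflictsBounded D xs → ConflictsBounded D zs
    ConflictsBounded-⊆ zs⊆xs bounded x =
      ℕ.≤-trans (Sublist.length-mono-≤ (Sublist.filter⁺ (x #?_) (x #?_) (λ {refl → id}) zs⊆xs)) (bounded x)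

    module _ (D : ℕ) where

      private
        c = ⟦ suc D ⟧

      -- The quantity 1 + e(xs ∖ x) - e(xs) is the jump of the conditional expected output size
      -- caused by the pick x. The pick accounts for 1 and the at most `D` deleted items for 1 each,
      -- hence the constant `suc D`.
      martingale-difference : ∀ xs → ConflictsBounded D xs → ∀ x →
                              ∣ expected (xs ∖ x) - (expected xs - 1ℚ) ∣ ≤ c
      martingale-difference xs bounded x = begin
        ∣ expected (xs ∖ x) - (expected xs - 1ℚ) ∣
          ≡⟨ cong ∣_∣ (regroup (expected (xs ∖ x)) (expected xs)) ⟩
        ∣ 1ℚ - (expected xs - expected (xs ∖ x)) ∣
          ≤⟨ ℚ.∣p-q∣≤∣p∣+∣q∣ 1ℚ (expected xs - expected (xs ∖ x)) ⟩
        1ℚ + ∣ expected xs - expected (xs ∖ x) ∣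
          ≤⟨ ℚ.+-monoʳ-≤ 1ℚ (⊆-Lipschitz (Sublist.filter-⊆ (λ y → ¬? (x #? y)) xs)) ⟩
        1ℚ + (⟦ length xs ⟧ - ⟦ length (xs ∖ x) ⟧)
          ≡⟨ cong (λ s → 1ℚ + (s - ⟦ length (xs ∖ x) ⟧))
               (trans (cong ⟦_⟧ (length-filter-complement (x #?_) xs)) (⟦⟧-+ conflicts (length (xs ∖ x)))) ⟩
        1ℚ + ((⟦ conflicts ⟧ + ⟦ length (xs ∖ x) ⟧) - ⟦ length (xs ∖ x) ⟧)
          ≡⟨ cancel ⟦ conflicts ⟧ ⟦ length (xs ∖ x) ⟧ ⟩
        1ℚ + ⟦ conflicts ⟧
          ≡⟨ ⟦⟧-+ 1 conflicts ⟨
        ⟦ suc conflicts ⟧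
          ≤⟨ ⟦⟧-mono (s≤s (bounded x)) ⟩
        c
          ∎
        where
        open ℚ.≤-Reasoning
        conflicts = length (filter (x #?_) xs)
        regroup : ∀ a b → a - (b - 1ℚ) ≡ 1ℚ - (b - a)
        regroup = solve-∀ ℚ-ring
        cancel : ∀ a b → 1ℚ + ((a + b) - b) ≡ 1ℚ + a
        cancel = solve-∀ ℚ-ring

      -- Law of total variance over the first pick, by induction on the fuel: the conditional
      -- variance is bounded inductively, and the squared jump by `c * c`.
      Var-steps : ∀ k xs → length xs ℕ.≤ k → ConflictsBounded D xs →
                  Var (steps k xs) size ≤ c * c * ⟦ length xs ⟧
      Var-steps zero    []           _    _       = ℚ.≤-reflexive (sym (ℚ.*-zeroʳ (c * c)))
      Var-steps (suc k) []           _    _       = ℚ.≤-reflexive (sym (ℚ.*-zeroʳ (c * c)))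
      Var-steps (suc k) xs@(x ∷ xs′) xs≤k bounded = begin
        Var (steps (suc k) xs) size
          ≡⟨ 𝔼-steps k x xs′ (λ S → (size S - m) * (size S - m)) ⟩
        𝔼 (uniform xs) (λ y → 𝔼 (steps k (xs ∖ y)) (λ S → (size (y ∷ S) - m) * (size (y ∷ S) - m)))
          ≡⟨ 𝔼-cong (uniform xs) conditional ⟩
        𝔼 (uniform xs) (λ y → Var (steps k (xs ∖ y)) size + (mean k (xs ∖ y) - (m - 1ℚ)) * (mean k (xs ∖ y) - (m - 1ℚ)))
          ≤⟨ 𝔼-uniform-mono xs conditional-≤ ⟩
        𝔼 (uniform xs) (λ _ → c * c * ⟦ length xs ⟧)
          ≡⟨ 𝔼-uniform-const x xs′ (c * c * ⟦ length xs ⟧) ⟩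
        c * c * ⟦ length xs ⟧
          ∎
        where
        open ℚ.≤-Reasoning
        m = mean (suc k) xs

        shift : ∀ a m → (1ℚ + a) - m ≡ a - (m - 1ℚ)
        shift = solve-∀ ℚ-ring

        conditional : ∀ y → 𝔼 (steps k (xs ∖ y)) (λ S → (size (y ∷ S) - m) * (size (y ∷ S) - m)) ≡
                      Var (steps k (xs ∖ y)) size + (mean k (xs ∖ y) - (m - 1ℚ)) * (mean k (xs ∖ y) - (m - 1ℚ))
        -- The picked item adds 1 to the size, so the deviation from `m` becomes that of the
        -- remaining run from `m - 1ℚ`.
        conditional y = trans
          (𝔼-cong (steps k (xs ∖ y)) λ S → cong (λ s → s * s)
            (trans (cong (_- m) (⟦⟧-+ 1 (length S))) (shift (size S) m)))
          (𝔼-shifted-square (steps k (xs ∖ y)) size (m - 1ℚ) (steps-mass k (xs ∖ y)))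

        conditional-≤ : ∀ {y} → y ∈ xs →
          Var (steps k (xs ∖ y)) size + (mean k (xs ∖ y) - (m - 1ℚ)) * (mean k (xs ∖ y) - (m - 1ℚ)) ≤
          c * c * ⟦ length xs ⟧
        conditional-≤ {y} y∈xs = begin
          Var (steps k (xs ∖ y)) size + (mean k (xs ∖ y) - (m - 1ℚ)) * (mean k (xs ∖ y) - (m - 1ℚ))
            ≤⟨ ℚ.+-mono-≤
                 (Var-steps k (xs ∖ y) xs∖y≤k (ConflictsBounded-⊆ (Sublist.filter-⊆ (λ z → ¬? (y #? z)) xs) bounded))
                 (∣p∣≤q⇒p*p≤q*q (subst (_≤ c)
                   (cong₂ (λ s t → ∣ s - (t - 1ℚ) ∣) (sym (mean≡expected (xs ∖ y) xs∖y≤k)) (sym (mean≡expected xs xs≤k)))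
                   (martingale-difference xs bounded y))) ⟩
          c * c * ⟦ length (xs ∖ y) ⟧ + c * c
            ≡⟨ factor (c * c) ⟦ length (xs ∖ y) ⟧ ⟩
          c * c * (1ℚ + ⟦ length (xs ∖ y) ⟧)
            ≡⟨ cong (λ s → c * c * s) (⟦⟧-+ 1 (length (xs ∖ y))) ⟨
          c * c * ⟦ suc (length (xs ∖ y)) ⟧
            -- The extra `c * c` of this round is paid for by the picked item, which is no longer in
            -- `xs ∖ y`.
            ≤⟨ ℚ.*-monoˡ-≤-nonNeg (c * c) {{c*c≥0}} (⟦⟧-mono (length-∖ y∈xs)) ⟩
          c * c * ⟦ length xs ⟧
            ∎
          where
          xs∖y≤k = length-∖-≤ y∈xs xs≤k
          c*c≥0 : NonNegative (c * c)
          c*c≥0 = ℚ.nonNeg*nonNeg⇒nonNeg c {{/-nonNeg (suc D) 1}} c {{/-nonNeg (suc D) 1}}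
          factor : ∀ a b → a * b + a ≡ a * (1ℚ + b)
          factor = solve-∀ ℚ-ring

      -- Scaling by 1/N multiplies the variance by 1/N², and one of these factors cancels against
      -- the length. `N` is kept apart from `length xs` since the vertex count equals the length of
      -- `allFin n` only propositionally.
      Var-greedy : ∀ {b} xs N .{{_ : ℕ.NonZero N}} → length xs ≡ N → ConflictsBounded D xs →
                   suc D ℕ.* suc D ℕ.≤ b →
                   Var (greedy _#?_ xs) (λ S → + length S / N) ≤ + b / N
      Var-greedy {b} xs N xs≡N bounded D²≤b = begin
        Var (greedy _#?_ xs) (λ S → + length S / N)
          ≡⟨ Var-cong (greedy _#?_ xs) (λ S → /≡*1/ (length S) N) ⟩
        Var (greedy _#?_ xs) (λ S → size S * 1/N)
          ≡⟨ Var-* (greedy _#?_ xs) size 1/N ⟩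
        1/N * 1/N * Var (greedy _#?_ xs) size
          ≤⟨ ℚ.*-monoˡ-≤-nonNeg (1/N * 1/N) {{ℚ.nonNeg*nonNeg⇒nonNeg 1/N 1/N}}
               (Var-steps (length xs) xs ℕ.≤-refl bounded) ⟩
        1/N * 1/N * (c * c * ⟦ length xs ⟧)
          ≡⟨ cong (λ l → 1/N * 1/N * (c * c * ⟦ l ⟧)) xs≡N ⟩
        1/N * 1/N * (c * c * ⟦ N ⟧)
          ≡⟨ regroup 1/N (c * c) ⟦ N ⟧ ⟩
        c * c * 1/N * (1/N * ⟦ N ⟧)
          ≡⟨ cong (λ s → c * c * 1/N * s) (1/*⟦⟧ N) ⟩
        c * c * 1/N * 1ℚ
          ≡⟨ ℚ.*-identityʳ (c * c * 1/N) ⟩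
        c * c * 1/N
          ≡⟨ cong (_* 1/N) (⟦⟧-* (suc D) (suc D)) ⟨
        ⟦ suc D ℕ.* suc D ⟧ * 1/N
          ≤⟨ ℚ.*-monoʳ-≤-nonNeg 1/N (⟦⟧-mono D²≤b) ⟩
        ⟦ b ⟧ * 1/N
          ≡⟨ /≡*1/ b N ⟨
        + b / N
          ∎
        where
        open ℚ.≤-Reasoning
        1/N = 1ℤ / N
        instance
          1/N≥0 : NonNegative 1/N
          1/N≥0 = /-nonNeg 1 N
        regroup : ∀ u k n → u * u * (k * n) ≡ k * u * (u * n)
        regroup = solve-∀ ℚ-ring

  -- The exponential factor is at least 1

  1≤expSum : ∀ x n → 1 ℕ.≤ n → 1ℚ ≤ expSum x n
  -- The term with k = 0 is already 1, and later terms are nonnegative. The empty sum at index 0 is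
  -- excluded.
  1≤expSum x (suc zero)    _ = ℚ.≤-refl
  1≤expSum x (suc (suc n)) _ = begin
    1ℚ                                            ≤⟨ 1≤expSum x (suc n) (s≤s z≤n) ⟩
    expSum x (suc n)                              ≡⟨ ℚ.+-identityʳ (expSum x (suc n)) ⟨
    expSum x (suc n) + 0ℚ                         ≤⟨ ℚ.+-monoʳ-≤ (expSum x (suc n)) (ℚ.nonNegative⁻¹ (expTerm x (suc n)) {{term≥0}}) ⟩
    expSum x (suc n) + expTerm x (suc n)          ∎
    where
    open ℚ.≤-Reasoning
    term≥0 : NonNegative (expTerm x (suc n))
    term≥0 = /-nonNeg (x ℕ.^ suc n) (suc n ℕ.!) {{suc n ℕ.!≢0}}

  -- All partial sums from index 1 on are at least 1, so 1 serves as threshold for every `ε`.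
  ≤⇒≤ℝ·exp : ∀ {p q} x .{{_ : NonNegative q}} → p ≤ q → fromℚ p ≤ℝ q · exp x
  ≤⇒≤ℝ·exp {p} {q} x p≤q ε = 1 , λ n 1≤n → begin
    p                          ≤⟨ p≤q ⟩
    q                          ≡⟨ ℚ.*-identityʳ q ⟨
    q * 1ℚ                     ≤⟨ ℚ.*-monoˡ-≤-nonNeg q (1≤expSum x n 1≤n) ⟩
    q * expSum x n             ≡⟨ ℚ.+-identityʳ (q * expSum x n) ⟨
    q * expSum x n + 0ℚ        ≤⟨ ℚ.+-monoʳ-≤ (q * expSum x n) (ℚ.<⇒≤ (ℚ.positive⁻¹ ε)) ⟩
    q * expSum x n + ε         ∎
    where open ℚ.≤-Reasoning

-- Counting conflicts of vertices and of edges

Unique-⊆⇒length-≤ : ∀ {xs ys : List A} → Unique xs → (∀ {x} → x ∈ xs → x ∈ ys) → length xs ℕ.≤ length ys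
Unique-⊆⇒length-≤ {xs = []}     _                _     = z≤n
Unique-⊆⇒length-≤ {xs = x ∷ xs} (x∉xs ∷ unique) xs⊆ys with ∈-∃++ (xs⊆ys (here refl))
-- The head x is cut out of the larger list. By uniqueness no later entry equals x, so the tail
-- still embeds into what is left.
... | ps , qs , refl = subst (suc (length xs) ℕ.≤_) (sym (List.length-++-sucʳ ps x qs))
  (s≤s (Unique-⊆⇒length-≤ unique λ y∈xs → skip (All.lookup x∉xs y∈xs ∘ sym) (xs⊆ys (there y∈xs))))
  where
  skip : ∀ {y} → y ≢ x → y ∈ ps ++ x ∷ qs → y ∈ ps ++ qs
  skip y≢x y∈ with ∈-++⁻ ps y∈
  ... | inj₁ y∈ps         = ∈-++⁺ˡ y∈ps
  ... | inj₂ (here y≡x)   = contradiction y≡x y≢x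
  ... | inj₂ (there y∈qs) = ∈-++⁺ʳ ps y∈qs

module _ {n} (G : Graph n) where

  open Graph G

  neighbours : Fin n → List (Fin n)
  neighbours v = filter (v ~?_) (allFin n)

  degree≤maxDegree : ∀ v → degree G v ℕ.≤ maxDegree G
  degree≤maxDegree v =
    All.lookup (Extrema.xs≤max 0 (map (degree G) (allFin n))) (∈-map⁺ (degree G) (∈-allFin v))

  ∈-neighbours : ∀ {u v} → u ~ v → v ∈ neighbours u
  ∈-neighbours {u} {v} u~v = ∈-filter⁺ (u ~?_) (∈-allFin v) u~v

  -- A vertex conflicts with itself and its neighbours, whence the successor.
  equalOrAdjacent-bounded : ∀ v → length (filter (equalOrAdjacent? G v) (allFin n)) ℕ.≤ suc (maxDegree G)
  equalOrAdjacent-bounded v = ℕ.≤-trans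
    (Unique-⊆⇒length-≤ (Unique.filter⁺ (equalOrAdjacent? G v) (Unique.allFin⁺ n)) covered)
    (s≤s (degree≤maxDegree v))
    where
    covered : ∀ {u} → u ∈ filter (equalOrAdjacent? G v) (allFin n) → u ∈ v ∷ neighbours v
    covered u∈ with proj₂ (∈-filter⁻ (equalOrAdjacent? G v) {xs = allFin n} u∈)
    ... | inj₁ v≡u = here (sym v≡u)
    ... | inj₂ v~u = there (∈-neighbours v~u)

  -- For adjacent u and v, the form in which `edges` lists the edge between them.
  sortedPair : Fin n → Fin n → Fin n × Fin n
  sortedPair u v = if does (u Fin.<? v) then (u , v) else (v , u)

  -- Every edge meeting e lies in the star of one of its endpoints, and a star has at most as many
  -- edges as the maximum degree. The stars may overlap, which only helps.
  shareEndpoint-bounded : ∀ e → length (filter (shareEndpoint? G e) (edges G)) ℕ.≤ maxDegree G ℕ.+ maxDegree G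
  shareEndpoint-bounded e@(i , j) = begin
    length (filter (shareEndpoint? G e) (edges G))
      ≤⟨ Unique-⊆⇒length-≤ (Unique.filter⁺ (shareEndpoint? G e) unique-edges) covered ⟩
    length (star i ++ star j)
      ≡⟨ List.length-++ (star i) ⟩
    length (star i) ℕ.+ length (star j)
      ≤⟨ ℕ.+-mono-≤ (length-star i) (length-star j) ⟩
    maxDegree G ℕ.+ maxDegree G
      ∎
    where
    open ℕ.≤-Reasoning
    star : Fin n → List (Fin n × Fin n)
    star u = map (sortedPair u) (neighbours u)
    length-star : ∀ u → length (star u) ℕ.≤ maxDegree G
    length-star u = subst (ℕ._≤ maxDegree G) (sym (List.length-map (sortedPair u) (neighbours u))) (degree≤maxDegree u)
    edge? = λ ((k , l) : Fin n × Fin n) → (k Fin.<? l) ×-dec (k ~? l)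
    unique-edges : Unique (edges G)
    unique-edges = Unique.filter⁺ edge? (Unique.cartesianProduct⁺ (Unique.allFin⁺ n) (Unique.allFin⁺ n))
    ∈-starˡ : ∀ {k l} → k Fin.< l → k ~ l → (k , l) ∈ star k
    ∈-starˡ {k} {l} k<l k~l = subst (_∈ star k)
      (cong (λ b → if b then (k , l) else (l , k)) (dec-true (k Fin.<? l) k<l))
      (∈-map⁺ (sortedPair k) (∈-neighbours k~l))
    ∈-starʳ : ∀ {k l} → k Fin.< l → k ~ l → (k , l) ∈ star l
    ∈-starʳ {k} {l} k<l k~l = subst (_∈ star l)
      -- Seen from its larger endpoint the edge is reversed: the test `l Fin.<? k` fails, and
      -- `sortedPair l k` returns `(k , l)`.
      (cong (λ b → if b then (l , k) else (k , l)) (dec-false (l Fin.<? k) (ℕ.<⇒≯ k<l)))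
      (∈-map⁺ (sortedPair l) (∈-neighbours (~-sym k~l)))
    covered : ∀ {f} → f ∈ filter (shareEndpoint? G e) (edges G) → f ∈ star i ++ star j
    covered {k , l} f∈ with ∈-filter⁻ (shareEndpoint? G e) {xs = edges G} f∈
    ... | f∈edges , shared with proj₂ (∈-filter⁻ edge? {xs = cartesianProduct (allFin n) (allFin n)} f∈edges)
    ... | k<l , k~l with shared
    ... | inj₁ (inj₁ refl) = ∈-++⁺ˡ (∈-starˡ k<l k~l)
    ... | inj₁ (inj₂ refl) = ∈-++⁺ˡ (∈-starʳ k<l k~l)
    ... | inj₂ (inj₁ refl) = ∈-++⁺ʳ (star i) (∈-starˡ k<l k~l)
    ... | inj₂ (inj₂ refl) = ∈-++⁺ʳ (star i) (∈-starʳ k<l k~l)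

  equalOrAdjacent-sym : Symmetric (EqualOrAdjacent G)
  equalOrAdjacent-sym (inj₁ u≡v) = inj₁ (sym u≡v)
  equalOrAdjacent-sym (inj₂ u~v) = inj₂ (~-sym u~v)

  shareEndpoint-sym : Symmetric (ShareEndpoint G)
  shareEndpoint-sym (inj₁ (inj₁ i≡k)) = inj₁ (inj₁ (sym i≡k))
  shareEndpoint-sym (inj₁ (inj₂ i≡l)) = inj₂ (inj₁ (sym i≡l))
  shareEndpoint-sym (inj₂ (inj₁ j≡k)) = inj₁ (inj₂ (sym j≡k))
  shareEndpoint-sym (inj₂ (inj₂ j≡l)) = inj₂ (inj₂ (sym j≡l))

-- Constants and conclusion

square≤9r² : ∀ {m} r → m ℕ.≤ 3 ℕ.* r → m ℕ.* m ℕ.≤ 9 ℕ.* r ℕ.^ 2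
square≤9r² r m≤3r = ℕ.≤-trans (ℕ.*-mono-≤ m≤3r m≤3r) (ℕ.≤-reflexive (square r))
  where
  square : ∀ r → 3 ℕ.* r ℕ.* (3 ℕ.* r) ≡ 9 ℕ.* (r ℕ.* (r ℕ.* 1))
  square = ℕ-solve-∀

open import Data.Nat.Base using (_≤_; _*_; _^_)
open import Data.Nat.Properties using (≤-trans; ≤-reflexive)

theorem6 : ∀ {n} (G : Graph n) (r : ℕ) (Δ≡r : maxDegree G ≡ r) (3≤r : 3 ≤ r) →
    let Δ>0 = ≤-trans (≤-trans (s≤s z≤n) 3≤r) (≤-reflexive (sym Δ≡r))
        instance
          V≢∅ = ∣V∣-nonZero G Δ>0
          E≢∅ = ∣E∣-nonZero G Δ>0
    in
      fromℚ (Var (𝓘𝓖 G) (λ I → + length I / ∣V∣ G))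
        ≤ℝ (+ (9 * r ^ 2) / ∣V∣ G) · exp ((r ∸ 1) ^ 3)
      ×
      fromℚ (Var (𝓜𝓖 G) (λ M → + length M / ∣E∣ G))
        ≤ℝ (+ (33 * r ^ 2) / ∣E∣ G) · exp ((r ∸ 1) ^ 3)
theorem6 {n} G r refl 3≤r =
  ≤⇒≤ℝ·exp ((r ∸ 1) ^ 3) {{/-nonNeg (9 * r ^ 2) n}}
    -- Here D = r + 1, and 1 + D = 2 + r is at most 3r because r is at least 2.
    (IG.Var-greedy (suc r) (allFin n) n (List.length-tabulate id) (equalOrAdjacent-bounded G)
      (square≤9r² r (≤3*r (ℕ.+-mono-≤ 2≤r (ℕ.m≤m+n r r))))) ,
  ≤⇒≤ℝ·exp ((r ∸ 1) ^ 3) {{/-nonNeg (33 * r ^ 2) (∣E∣ G)}}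
    -- Here D = 2r, and 1 + D is at most 3r because r is at least 1. This gives 9r², which is
    -- relaxed to 33r².
    (MG.Var-greedy (r ℕ.+ r) (edges G) (∣E∣ G) refl (shareEndpoint-bounded G)
      (≤-trans (square≤9r² r (≤3*r (ℕ.+-monoˡ-≤ (r ℕ.+ r) Δ>0)))
               (ℕ.*-monoˡ-≤ (r ^ 2) {9} {33} (ℕ.m≤m+n 9 24))))
  where
  module IG = Greedy (equalOrAdjacent? G) (inj₁ refl) (equalOrAdjacent-sym G)
  module MG = Greedy (shareEndpoint? G) (inj₁ (inj₁ refl)) (shareEndpoint-sym G)
  2≤r : 2 ≤ r
  2≤r = ≤-trans (s≤s (s≤s z≤n)) 3≤r
  Δ>0 = ≤-trans (s≤s z≤n) 3≤r
  instance
    V≢∅ = ∣V∣-nonZero G Δ>0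
    E≢∅ = ∣E∣-nonZero G Δ>0
  ≤3*r : ∀ {m} → m ≤ r ℕ.+ (r ℕ.+ r) → m ≤ 3 * r
  ≤3*r {m} = subst (λ s → m ≤ r ℕ.+ (r ℕ.+ s)) (sym (ℕ.+-identityʳ r))
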